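{- Let $\mathcal{S}$ be the class of all Stalnakerian selection frames. Then the logic $\mathsf{L}(\mathcal{S})$, i.e. the set of all formulas of the language $\mathcal{L}$ of quantified conditional logic that are valid in every Stalnakerian selection frame, is not recursively axiomatizable.
   Context: Language. There are countably many individual variables and, for each $n$, countably many $n$-place predicates. Formulas of $\mathcal{L}$: $\phi ::= P^n(x_1,\dots,x_n) \mid \neg\phi \mid (\phi\to\phi)\mid(\phi > \phi)\mid \forall x\,\phi$, where $>$ is a binary (conditional) connective. There is no identity symbol. Frames. A selection frame is $\mathcal{F}=\langle W,R,f,D,d\rangle$ where $W\neq\varnothing$ is a set (worlds), $R\subseteq W\times W$, $f:\mathcal{P}(W)\times W\to\mathcal{P}(W)$, $D\neq\varnothing$ is a set, $d:W\to\mathcal{P}(D)$ (local domains may be empty), and $f(P,w)\subseteq R(w):=\{x\in W\mid wRx\}$ for all $P\subseteq W$, $w\in W$. It is Stalnakerian if for all $P,Q\subseteq W$, $w\in W$: (1) $f(P,w)\subseteq P$; (2) if $w\in P$ then $w\in f(P,w)$; (3) if $f(P,w)=\varnothing$ then $P\cap R(w)=\varnothing$; (4) if $f(P,w)\subseteq Q$ and $f(Q,w)\subseteq P$ then $f(P,w)=f(Q,w)$; (5) $|f(P,w)|\le 1$. Models. A model $\mathcal{M}$ based on $\mathcal{F}$ adds an interpretation $I$ with $I(P^n,w)\subseteq D^n$ for each $n$-place predicate $P^n$ and $w\in W$. A variable assignment $g$ maps variables into $D$; $g^x_a$ is $g$ changed to send $x$ to $a$. Satisfaction, with $[\phi]^g=\{w\in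 W\mid \mathcal{M},w,g\Vdash\phi\}$: $\mathcal{M},w,g\Vdash P^n(x_1,\dots,x_n)$ iff $\langle g(x_1),\dots,g(x_n)\rangle\in I(P^n,w)$; $\neg,\to$ are classical at each world; $\mathcal{M},w,g\Vdash\forall x\phi$ iff $\mathcal{M},w,g^x_a\Vdash\phi$ for all $a\in d(w)$; $\mathcal{M},w,g\Vdash\phi>\psi$ iff $f([\phi]^g,w)\subseteq[\psi]^g$. A formula is valid in a frame if it is satisfied in every model based on it, at every world, under every assignment. For a class of frames $\mathcal{C}$, $\mathsf{L}(\mathcal{C})$ is the set of formulas valid in every frame of $\mathcal{C}$. A set of formulas is recursively axiomatizable if it is the set of theorems of a formal system with a decidable set of axioms and decidable rules of inference; equivalently, if it is recursively enumerable (under a standard coding of formulas). -}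

module Defs where

open import Data.Bool.Base using (if_then_else_)
open import Data.Fin.Base using (Fin)
open import Data.List.Base using (List; []; _∷_)
open import Data.List.Relation.Unary.All using (All)
open import Data.Nat.Base using (ℕ; zero; suc; _+_; _≤_; _<_; z≤n; s≤s)
open import Data.Nat.Properties
  using (_≟_; <-cmp; +-comm; +-cancelˡ-≡; +-mono-≤; +-monoʳ-≤; m≤m+n; <-irrefl; n<1+n; suc-injective;
         module ≤-Reasoning)
open import Data.Product.Base using (_×_; _,_; ∃; ∃₂)
open import Data.Sum.Base using (_⊎_)
open import Data.Vec.Base using (Vec; []; _∷_; lookup; map)
open import Data.Vec.Relation.Binary.Pointwise.Inductive using (Pointwise)
open import Function.Bundles using (_⇔_)
open import Level using (Level; 0ℓ; _⊔_) renaming (suc to lsuc)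
open import Relation.Binary.Core using (Rel; REL)
open import Relation.Binary.Definitions using (tri<; tri≈; tri>)
open import Relation.Binary.PropositionalEquality
  using (_≡_; refl; sym; trans; cong; cong₂)
open import Relation.Nullary using (¬_; does; contradiction)
open import Relation.Unary using (Pred; _∈_; _∩_; _⊆_; _≐_; Empty)

private
  variable
    ℓ : Level
    m n : ℕ

Var : Set
Var = ℕ

infixr 6 _⇒_ _>_

data Formula : Set where
  -- atom n i xs applies the i-th n-place predicate to the variables xs.
  atom : (n i : ℕ) → Vec Var n → Formula
  neg  : Formula → Formula
  _⇒_  : Formula → Formula → Formula
  _>_  : Formula → Formula → Formula
  all  : Var → Formula → Formula

record SelectionFrame : Set₁ where
  field
    W      : Set
    W-elem : W
    R      : Rel W 0ℓ
    f      : Pred W 0ℓ → W → Pred W 0ℓ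
    D      : Set
    D-elem : D
    d      : W → Pred D 0ℓ
    -- Sets of worlds are compared extensionally, so f, as a function on
    -- the powerset of W, has to respect _≐_.
    f-cong : ∀ {P Q} w → P ≐ Q → f P w ≐ f Q w
    f⊆R    : ∀ P w → f P w ⊆ R w

record Stalnakerian (F : SelectionFrame) : Set₁ where
  open SelectionFrame F
  field
    success     : ∀ P w → f P w ⊆ P
    centering   : ∀ P w → w ∈ P → w ∈ f P w
    vacuity     : ∀ P w → Empty (f P w) → Empty (P ∩ R w)
    reciprocity : ∀ P Q w → f P w ⊆ Q → f Q w ⊆ P → f P w ≐ f Q w
    uniqueness  : ∀ P w {x y} → x ∈ f P w → y ∈ f P w → x ≡ y

record Model (F : SelectionFrame) : Set₁ where
  open SelectionFrame F
  field
    I : (n i : ℕ) → W → Pred (Vec D n) 0ℓ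

_[_≔_] : {D : Set} → (Var → D) → Var → D → (Var → D)
(g [ x ≔ a ]) y = if does (y ≟ x) then a else g y

module _ {F : SelectionFrame} (M : Model F) where
  open SelectionFrame F
  open Model M

  -- The clauses for neg and _⇒_ are the classical ones once excluded
  -- middle is assumed.
  ⟦_⟧ : Formula → (Var → D) → Pred W 0ℓ
  ⟦ atom n i xs ⟧ g w = map g xs ∈ I n i w
  ⟦ neg φ       ⟧ g w = ¬ ⟦ φ ⟧ g w
  ⟦ φ ⇒ ψ       ⟧ g w = ⟦ φ ⟧ g w → ⟦ ψ ⟧ g w
  ⟦ φ > ψ       ⟧ g w = f (⟦ φ ⟧ g) w ⊆ ⟦ ψ ⟧ g
  ⟦ all x φ     ⟧ g w = ∀ a → a ∈ d w → ⟦ φ ⟧ (g [ x ≔ a ]) w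

ValidIn : SelectionFrame → Pred Formula (lsuc 0ℓ)
ValidIn F φ = ∀ (M : Model F) w (g : Var → D) → ⟦ M ⟧ φ g w
  where open SelectionFrame F using (D)

L : Pred SelectionFrame (lsuc 0ℓ) → Pred Formula (lsuc 0ℓ)
L C φ = ∀ F → F ∈ C → ValidIn F φ

data Rec : ℕ → Set where
  zeroᴿ : Rec n
  sucᴿ  : Rec 1
  proj  : Fin n → Rec n
  comp  : Rec m → Vec (Rec n) m → Rec n
  prec  : Rec n → Rec (2 + n) → Rec (1 + n)
  mu    : Rec (1 + n) → Rec n

-- e [ xs ]⇓ y: the computation of e on xs terminates with value y.
-- Excluded middle makes every predicate decidable by an Agda function, so
-- computability must refer to such a relation and not to the type ℕ → ℕ.
data _[_]⇓_ : Rec n → Vec ℕ n → ℕ → Set where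
  ⇓zero  : {xs : Vec ℕ n} → zeroᴿ [ xs ]⇓ 0
  ⇓suc   : ∀ {x} → sucᴿ [ x ∷ [] ]⇓ suc x
  ⇓proj  : {xs : Vec ℕ n} (i : Fin n) → proj i [ xs ]⇓ lookup xs i
  ⇓comp  : ∀ {h : Rec m} {es : Vec (Rec n) m} {xs ys z} →
           Pointwise (λ e y → e [ xs ]⇓ y) es ys →
           h [ ys ]⇓ z →
           comp h es [ xs ]⇓ z
  ⇓prec₀ : ∀ {b : Rec n} {s xs y} →
           b [ xs ]⇓ y →
           prec b s [ 0 ∷ xs ]⇓ y
  ⇓precₛ : ∀ {b : Rec n} {s xs t y z} →
           prec b s [ t ∷ xs ]⇓ y →
           s [ t ∷ y ∷ xs ]⇓ z →
           prec b s [ suc t ∷ xs ]⇓ z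
  ⇓mu    : ∀ {h : Rec (1 + n)} {xs y} →
           h [ y ∷ xs ]⇓ 0 →
           (∀ z → z < y → ∃ λ v → h [ z ∷ xs ]⇓ suc v) →
           mu h [ xs ]⇓ y

Recursive : Pred (Vec ℕ n) ℓ → Set ℓ
Recursive {n = n} A = ∃ λ (e : Rec n) → ∀ xs →
  (A xs × e [ xs ]⇓ 1) ⊎ (¬ A xs × e [ xs ]⇓ 0)

triangle : ℕ → ℕ
triangle zero    = 0
triangle (suc n) = suc n + triangle n

-- Cantor's pairing function.
pair : ℕ → ℕ → ℕ
pair a b = triangle (a + b) + a

codeVec : Vec ℕ n → ℕ
codeVec []       = 0
codeVec (x ∷ xs) = pair x (codeVec xs)

⌜_⌝ : Formula → ℕ
⌜ atom n i xs ⌝ = pair 0 (pair n (pair i (codeVec xs)))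
⌜ neg φ       ⌝ = pair 1 ⌜ φ ⌝
⌜ φ ⇒ ψ       ⌝ = pair 2 (pair ⌜ φ ⌝ ⌜ ψ ⌝)
⌜ φ > ψ       ⌝ = pair 3 (pair ⌜ φ ⌝ ⌜ ψ ⌝)
⌜ all x φ     ⌝ = pair 4 (pair x ⌜ φ ⌝)

⌜_⌝* : List Formula → ℕ
⌜ []    ⌝* = 0
⌜ φ ∷ Γ ⌝* = suc (pair ⌜ φ ⌝ ⌜ Γ ⌝*)

triangle-mono : m ≤ n → triangle m ≤ triangle n
triangle-mono {zero}  _           = z≤n
triangle-mono {suc m} (s≤s {n = n} m≤n) =
  s≤s (+-mono-≤ m≤n (triangle-mono m≤n))

private
  pair-mono-< : ∀ {a b c e} → a + b < c + e → pair a b < pair c e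
  pair-mono-< {a} {b} {c} {e} lt = begin-strict
    triangle (a + b) + a              ≤⟨ +-monoʳ-≤ (triangle (a + b)) (m≤m+n a b) ⟩
    triangle (a + b) + (a + b)        ≡⟨ +-comm (triangle (a + b)) (a + b) ⟩
    (a + b) + triangle (a + b)        <⟨ n<1+n _ ⟩
    triangle (suc (a + b))            ≤⟨ triangle-mono lt ⟩
    triangle (c + e)                  ≤⟨ m≤m+n _ c ⟩
    triangle (c + e) + c              ∎
    where open ≤-Reasoning

pair-injective : ∀ a b c e → pair a b ≡ pair c e → a ≡ c × b ≡ e
pair-injective a b c e eq with <-cmp (a + b) (c + e)
... | tri< lt _ _ = contradiction (pair-mono-< {a} {b} {c} {e} lt) (<-irrefl eq)
... | tri> _ _ gt = contradiction (pair-mono-< {c} {e} {a} {b} gt) (<-irrefl (sym eq))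
... | tri≈ _ s _  = a≡c , +-cancelˡ-≡ c b e (trans (cong (_+ b) (sym a≡c)) s)
  where
  a≡c : a ≡ c
  a≡c = +-cancelˡ-≡ (triangle (c + e)) a c
          (trans (cong (λ t → triangle t + a) (sym s)) eq)

codeVec-injective : (xs ys : Vec ℕ n) → codeVec xs ≡ codeVec ys → xs ≡ ys
codeVec-injective []       []       _  = refl
codeVec-injective (x ∷ xs) (y ∷ ys) eq with pair-injective x (codeVec xs) y (codeVec ys) eq
... | refl , eq′ = cong (x ∷_) (codeVec-injective xs ys eq′)

⌜⌝-injective : ∀ φ ψ → ⌜ φ ⌝ ≡ ⌜ ψ ⌝ → φ ≡ ψ
⌜⌝-injective φ ψ eq =
  go φ ψ (pair-injective (tag φ) (body φ) (tag ψ) (body ψ)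
            (trans (sym (split φ)) (trans eq (split ψ))))
  where
  tag body : Formula → ℕ
  tag (atom _ _ _) = 0
  tag (neg _)      = 1
  tag (_ ⇒ _)      = 2
  tag (_ > _)      = 3
  tag (all _ _)    = 4
  body (atom n i xs) = pair n (pair i (codeVec xs))
  body (neg φ)       = ⌜ φ ⌝
  body (φ ⇒ ψ)       = pair ⌜ φ ⌝ ⌜ ψ ⌝
  body (φ > ψ)       = pair ⌜ φ ⌝ ⌜ ψ ⌝
  body (all x φ)     = pair x ⌜ φ ⌝
  split : ∀ φ → ⌜ φ ⌝ ≡ pair (tag φ) (body φ)
  split (atom _ _ _) = refl
  split (neg _)      = refl
  split (_ ⇒ _)      = refl
  split (_ > _)      = refl
  split (all _ _)    = refl
  go : ∀ φ ψ → tag φ ≡ tag ψ × body φ ≡ body ψ → φ ≡ ψ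
  go (atom n i xs) (atom m j ys) (_ , e) with pair-injective n (pair i (codeVec xs)) m (pair j (codeVec ys)) e
  ... | refl , e′ with pair-injective i (codeVec xs) j (codeVec ys) e′
  ... | refl , e″ = cong (atom n i) (codeVec-injective xs ys e″)
  go (neg φ) (neg ψ) (_ , e) = cong neg (⌜⌝-injective φ ψ e)
  go (φ ⇒ φ′) (ψ ⇒ ψ′) (_ , e) with pair-injective ⌜ φ ⌝ ⌜ φ′ ⌝ ⌜ ψ ⌝ ⌜ ψ′ ⌝ e
  ... | p , q = cong₂ _⇒_ (⌜⌝-injective φ ψ p) (⌜⌝-injective φ′ ψ′ q)
  go (φ > φ′) (ψ > ψ′) (_ , e) with pair-injective ⌜ φ ⌝ ⌜ φ′ ⌝ ⌜ ψ ⌝ ⌜ ψ′ ⌝ e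
  ... | p , q = cong₂ _>_ (⌜⌝-injective φ ψ p) (⌜⌝-injective φ′ ψ′ q)
  go (all x φ) (all y ψ) (_ , e) with pair-injective x ⌜ φ ⌝ y ⌜ ψ ⌝ e
  ... | p , q = cong₂ all p (⌜⌝-injective φ ψ q)

⌜⌝*-injective : ∀ Γ Δ → ⌜ Γ ⌝* ≡ ⌜ Δ ⌝* → Γ ≡ Δ
⌜⌝*-injective []      []      _  = refl
⌜⌝*-injective (φ ∷ Γ) (ψ ∷ Δ) eq with pair-injective ⌜ φ ⌝ ⌜ Γ ⌝* ⌜ ψ ⌝ ⌜ Δ ⌝* (suc-injective eq)
... | p , q = cong₂ _∷_ (⌜⌝-injective φ ψ p) (⌜⌝*-injective Γ Δ q)

-- A rule relates finite lists of premises to conclusions.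
Rule : Set₁
Rule = REL (List Formula) Formula 0ℓ

setCodes : Pred Formula 0ℓ → Pred (Vec ℕ 1) 0ℓ
setCodes A (c ∷ []) = ∃ λ φ → ⌜ φ ⌝ ≡ c × A φ

ruleCodes : Rule → Pred (Vec ℕ 2) 0ℓ
ruleCodes r (b ∷ c ∷ []) = ∃₂ λ Γ φ → ⌜ Γ ⌝* ≡ b × ⌜ φ ⌝ ≡ c × r Γ φ

DecidableSet : Pred Formula 0ℓ → Set
DecidableSet A = Recursive (setCodes A)

DecidableRule : Rule → Set
DecidableRule r = Recursive (ruleCodes r)

record FormalSystem : Set₁ where
  field
    Axiom     : Pred Formula 0ℓ
    Axiom-dec : DecidableSet Axiom
    #rules    : ℕ
    rule      : Fin #rules → Rule
    rule-dec  : ∀ i → DecidableRule (rule i)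

data Theorem (S : FormalSystem) : Pred Formula 0ℓ where
  axiom : ∀ {φ} → FormalSystem.Axiom S φ → Theorem S φ
  infer : ∀ i {Γ φ} → FormalSystem.rule S i Γ φ →
          All (Theorem S) Γ → Theorem S φ

RecursivelyAxiomatizable : Pred Formula ℓ → Set (lsuc 0ℓ ⊔ ℓ)
RecursivelyAxiomatizable A = ∃ λ (S : FormalSystem) → ∀ φ → A φ ⇔ Theorem S φ

{-# OPTIONS --safe #-}

-- In a Stalnakerian frame f(·, w) well-orders R(w): every set of worlds meeting R(w) has a first
-- element there. Attach worlds to the individuals in the domain of w by a one-place predicate.
-- A finite list of axioms, one of which uses > to say that the predecessor of an individual has
-- an earlier first world, then makes each of these individuals stand for a natural number, with no
-- nonstandard elements. Hence a relation on ℕ given by Horn clauses can be described in the language: with an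
-- additional argument for the stage at which a tuple enters the relation, it is enough to demand
-- that tuples entering at stage n + 1 are justified by tuples that entered at stage n. The
-- evaluation of recursive functions and the theorems of a formal system are such relations, so if
-- the logic were axiomatized by a system, a sentence saying of itself that it is not a theorem of
-- the system would be valid if and only if it is not a theorem.

module Submission where

open import Defs
open import Axiom.ExcludedMiddle using (ExcludedMiddle)
open import Data.Bool.Base using (true; false)
open import Data.Empty using (⊥; ⊥-elim)
open import Data.Fin.Base using (Fin; zero; suc; toℕ)
open import Data.List.Base using (List; []; _∷_; foldr)
open import Data.List.Relation.Unary.All using (All; []; _∷_)
open import Data.Nat.Base using (ℕ; zero; suc; _+_; _≤_; _<_; _⊔_; z≤n; s≤s)
open import Data.Nat.Induction using (<-rec)
open import Data.Nat.Properties using (_≟_; <-cmp; +-comm; +-suc; +-identityʳ; suc-injective; m≤m⊔n; m≤n⊔m; n<1+n; m<n⇒m<1+n; m<1+n⇒m<n∨m≡n; ≤-refl; ≤-reflexive; ≤-trans; ≤-antisym; ≮⇒≥; n≤1+n; 1+n≢n)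
open import Data.Product.Base using (_×_; _,_; ∃; proj₁; proj₂)
open import Data.Sum.Base using (_⊎_; inj₁; inj₂)
open import Data.Unit.Base using (⊤; tt)
open import Data.Vec.Base using (Vec; []; _∷_; lookup)
open import Data.Vec.Relation.Binary.Pointwise.Inductive using (Pointwise; []; _∷_)
open import Function.Bundles using (_⇔_; Equivalence)
open import Level using (0ℓ) renaming (suc to lsuc)
open import Relation.Binary.Definitions using (tri<; tri≈; tri>)
open import Relation.Binary.PropositionalEquality using (_≡_; refl; sym; trans; cong; cong₂; subst; subst₂)
open import Relation.Nullary using (¬_; yes; no; does)
open import Relation.Nullary.Decidable using (decidable-stable)
open import Relation.Unary using (Pred; _∈_; _⊆_)

private
  variable
    m n : ℕ

-- Recursive functions

⇓-deterministic : (e : Rec n) → ∀ {xs y z} → e [ xs ]⇓ y → e [ xs ]⇓ z → y ≡ z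
⇓-deterministic* : (es : Vec (Rec n) m) → ∀ {xs ys zs} →
  Pointwise (λ e y → e [ xs ]⇓ y) es ys → Pointwise (λ e y → e [ xs ]⇓ y) es zs → ys ≡ zs
⇓-deterministic zeroᴿ ⇓zero ⇓zero = refl
⇓-deterministic sucᴿ ⇓suc ⇓suc = refl
⇓-deterministic (proj i) (⇓proj _) (⇓proj _) = refl
⇓-deterministic (comp h es) (⇓comp ps p) (⇓comp qs q)
  with refl ← ⇓-deterministic* es ps qs = ⇓-deterministic h p q
⇓-deterministic (prec b s) (⇓prec₀ p) (⇓prec₀ q) = ⇓-deterministic b p q
⇓-deterministic (prec b s) (⇓precₛ p p′) (⇓precₛ q q′)
  with refl ← ⇓-deterministic (prec b s) p q = ⇓-deterministic s p′ q′
⇓-deterministic (mu h) (⇓mu {y = y} p ps) (⇓mu {y = z} q qs) with <-cmp y z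
... | tri≈ _ y≡z _ = y≡z
... | tri< y<z _ _ with () ← ⇓-deterministic h p (proj₂ (qs y y<z))
... | tri> _ _ z<y with () ← ⇓-deterministic h q (proj₂ (ps z z<y))
⇓-deterministic* [] [] [] = refl
⇓-deterministic* (e ∷ es) (p ∷ ps) (q ∷ qs) =
  cong₂ _∷_ (⇓-deterministic e p q) (⇓-deterministic* es ps qs)

constᴿ : ℕ → Rec n
constᴿ zero    = zeroᴿ
constᴿ (suc k) = comp sucᴿ (constᴿ k ∷ [])

⇓const : ∀ k {xs : Vec ℕ n} → constᴿ k [ xs ]⇓ k
⇓const zero    = ⇓zero
⇓const (suc k) = ⇓comp (⇓const k ∷ []) ⇓suc

addᴿ : Rec 2
addᴿ = prec (proj zero) (comp sucᴿ (proj (suc zero) ∷ []))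

⇓add : ∀ a b → addᴿ [ a ∷ b ∷ [] ]⇓ (a + b)
⇓add zero    b = ⇓prec₀ (⇓proj zero)
⇓add (suc a) b = ⇓precₛ (⇓add a b) (⇓comp (⇓proj (suc zero) ∷ []) ⇓suc)

triangleᴿ : Rec 1
triangleᴿ = prec zeroᴿ (comp addᴿ (comp sucᴿ (proj zero ∷ []) ∷ proj (suc zero) ∷ []))

⇓triangle : ∀ a → triangleᴿ [ a ∷ [] ]⇓ triangle a
⇓triangle zero    = ⇓prec₀ ⇓zero
⇓triangle (suc a) = ⇓precₛ (⇓triangle a)
  (⇓comp (⇓comp (⇓proj zero ∷ []) ⇓suc ∷ ⇓proj (suc zero) ∷ []) (⇓add (suc a) (triangle a)))

pairᴿ : Rec n → Rec n → Rec n
pairᴿ e e′ = comp addᴿ (comp triangleᴿ (comp addᴿ (e ∷ e′ ∷ []) ∷ []) ∷ e ∷ [])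

⇓pair : ∀ {e e′ : Rec n} {xs a b} → e [ xs ]⇓ a → e′ [ xs ]⇓ b → pairᴿ e e′ [ xs ]⇓ pair a b
⇓pair {a = a} {b} p q =
  ⇓comp (⇓comp (⇓comp (p ∷ q ∷ []) (⇓add a b) ∷ []) (⇓triangle (a + b)) ∷ p ∷ [])
        (⇓add (triangle (a + b)) a)

prefixᴿ : List ℕ → Rec n → Rec n
prefixᴿ ks e = foldr (λ k → pairᴿ (constᴿ k)) e ks

⇓prefix : ∀ ks {e : Rec n} {xs a} → e [ xs ]⇓ a → prefixᴿ ks e [ xs ]⇓ foldr pair a ks
⇓prefix []       p = p
⇓prefix (k ∷ ks) p = ⇓pair (⇓const k) (⇓prefix ks p)

-- Serves as a disjunction: when all summands terminate, the sum is positive exactly if some summand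
-- is.
sumᴿ : ∀ k → (Fin k → Rec n) → Rec n
sumᴿ zero    es = zeroᴿ
sumᴿ (suc k) es = comp addᴿ (es zero ∷ sumᴿ k (λ i → es (suc i)) ∷ [])

⇓sum-total : ∀ k (es : Fin k → Rec n) {xs} →
  (∀ i → ∃ λ v → es i [ xs ]⇓ v) → ∃ λ v → sumᴿ k es [ xs ]⇓ v
⇓sum-total zero    es total = 0 , ⇓zero
⇓sum-total (suc k) es total
  with v , p ← total zero | w , q ← ⇓sum-total k (λ i → es (suc i)) (λ i → total (suc i))
  = v + w , ⇓comp (p ∷ q ∷ []) (⇓add v w)

⇓sum-positive : ∀ k (es : Fin k → Rec n) {xs} →
  (∀ i → ∃ λ v → es i [ xs ]⇓ v) →
  ∀ i {u} → es i [ xs ]⇓ suc u → ∃ λ v → sumᴿ k es [ xs ]⇓ suc v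
⇓sum-positive (suc k) es total zero {u} p
  with w , q ← ⇓sum-total k (λ i → es (suc i)) (λ i → total (suc i))
  = u + w , ⇓comp (p ∷ q ∷ []) (⇓add (suc u) w)
⇓sum-positive (suc k) es {xs} total (suc i) p
  with v , q ← total zero | w , r ← ⇓sum-positive k (λ i → es (suc i)) (λ i → total (suc i)) i p
  = v + w , subst (sumᴿ (suc k) es [ xs ]⇓_) (+-suc v w) (⇓comp (q ∷ r ∷ []) (⇓add v (suc w)))

⇓sum-positive⁻¹ : ∀ k (es : Fin k → Rec n) {xs v} → sumᴿ k es [ xs ]⇓ suc v →
  ∃ λ i → ∃ λ u → es i [ xs ]⇓ suc u
⇓sum-positive⁻¹ (suc k) es (⇓comp (_∷_ {x = _} {y = suc u} p _) _) = zero , u , p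
⇓sum-positive⁻¹ (suc k) es (⇓comp (_∷_ {y = zero} p (_∷_ {y = w} q [])) r)
  with refl ← ⇓-deterministic addᴿ r (⇓add zero w)
  with i , u , s ← ⇓sum-positive⁻¹ k (λ i → es (suc i)) q = suc i , u , s

-- Codes of programs

codeRec : Rec n → ℕ
codeRecs : Vec (Rec n) m → ℕ
codeRec zeroᴿ       = pair 0 0
codeRec sucᴿ        = pair 1 0
codeRec (proj i)    = pair 2 (toℕ i)
codeRec (comp h es) = pair 3 (pair (codeRec h) (codeRecs es))
codeRec (prec b s)  = pair 4 (pair (codeRec b) (codeRec s))
codeRec (mu h)      = pair 5 (codeRec h)
codeRecs []         = 0
codeRecs (e ∷ es)   = suc (pair (codeRec e) (codeRecs es))

-- Horn clauses on the natural numbers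

data Symbol : Set where
  pairing nth evaluation evaluations below theorems : Symbol

infixr 8 _∧ᴴ_
infixr 7 _∨ᴴ_

data Body : Set where
  zeroᴴ     : Var → Body
  sucᴴ      : Var → Var → Body
  rel       : Symbol → Var → Var → Var → Body
  _∧ᴴ_ _∨ᴴ_ : Body → Body → Body
  ∃ᴴ        : Var → Body → Body

Relations : Set₁
Relations = Symbol → ℕ → ℕ → ℕ → Set

⟪_⟫ : Body → Relations → (Var → ℕ) → Set
⟪ zeroᴴ x     ⟫ R ρ = ρ x ≡ 0
⟪ sucᴴ x y    ⟫ R ρ = ρ y ≡ suc (ρ x)
⟪ rel s x y z ⟫ R ρ = R s (ρ x) (ρ y) (ρ z)
⟪ p ∧ᴴ q      ⟫ R ρ = ⟪ p ⟫ R ρ × ⟪ q ⟫ R ρ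
⟪ p ∨ᴴ q      ⟫ R ρ = ⟪ p ⟫ R ρ ⊎ ⟪ q ⟫ R ρ
⟪ ∃ᴴ x p      ⟫ R ρ = ∃ λ a → ⟪ p ⟫ R (ρ [ x ≔ a ])

args : ℕ → ℕ → ℕ → Var → ℕ
args a b c 0 = a
args a b c 1 = b
args a b c _ = c

-- A case distinction on a tag. Each nested use in `q` tests the predecessor, kept in the next
-- variable, and so compares the tag with the next number.
unlessZero : Var → Body → Body → Body
unlessZero x p q = zeroᴴ x ∧ᴴ p ∨ᴴ ∃ᴴ (suc x) (sucᴴ (suc x) x ∧ᴴ q)

-- The arguments of the symbol being defined are the variables 0, 1 and 2.
body : Symbol → Body
body pairing =
  zeroᴴ 0 ∧ᴴ zeroᴴ 1 ∧ᴴ zeroᴴ 2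
  ∨ᴴ ∃ᴴ 3 (∃ᴴ 4 (sucᴴ 3 2 ∧ᴴ
      (zeroᴴ 0 ∧ᴴ sucᴴ 4 1 ∧ᴴ rel pairing 4 0 3
       ∨ᴴ ∃ᴴ 5 (sucᴴ 4 0 ∧ᴴ sucᴴ 1 5 ∧ᴴ rel pairing 4 5 3))))
body nth = ∃ᴴ 3 (∃ᴴ 4 (rel pairing 3 4 1 ∧ᴴ
  -- Bodies have no equality: that 2 is the head 3 is expressed by its forming the same pair with
  -- the tail 4.
  (zeroᴴ 0 ∧ᴴ rel pairing 2 4 1
   ∨ᴴ ∃ᴴ 5 (sucᴴ 5 0 ∧ᴴ rel nth 5 4 2))))
-- Variable 4 is the tag of the program coded by variable 0, variable 3 the rest of its code.
body evaluation = ∃ᴴ 3 (∃ᴴ 4 (rel pairing 4 3 0 ∧ᴴ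
  unlessZero 4 (zeroᴴ 2)
  (unlessZero 5 (∃ᴴ 10 (∃ᴴ 11 (rel pairing 10 11 1 ∧ᴴ sucᴴ 10 2)))
  (unlessZero 6 (rel nth 3 1 2)
  (unlessZero 7 (∃ᴴ 10 (∃ᴴ 11 (∃ᴴ 12
     (rel pairing 10 11 3 ∧ᴴ rel evaluations 11 1 12 ∧ᴴ rel evaluation 10 12 2))))
  (unlessZero 8 (∃ᴴ 10 (∃ᴴ 11 (∃ᴴ 12 (∃ᴴ 13 (rel pairing 10 11 3 ∧ᴴ rel pairing 12 13 1 ∧ᴴ
     (zeroᴴ 12 ∧ᴴ rel evaluation 10 13 2
      ∨ᴴ ∃ᴴ 14 (∃ᴴ 15 (∃ᴴ 16 (∃ᴴ 17 (∃ᴴ 18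
        (sucᴴ 14 12 ∧ᴴ rel pairing 14 13 15 ∧ᴴ rel evaluation 0 15 16 ∧ᴴ
         rel pairing 16 13 17 ∧ᴴ rel pairing 14 17 18 ∧ᴴ rel evaluation 11 18 2)))))))))))
  (∃ᴴ 10 (∃ᴴ 11
     (rel pairing 2 1 10 ∧ᴴ zeroᴴ 11 ∧ᴴ rel evaluation 3 10 11 ∧ᴴ rel below 3 1 2)))))))))
body evaluations =
  zeroᴴ 0 ∧ᴴ zeroᴴ 2
  ∨ᴴ ∃ᴴ 3 (∃ᴴ 4 (∃ᴴ 5 (∃ᴴ 6 (∃ᴴ 7 (sucᴴ 3 0 ∧ᴴ rel pairing 4 5 3 ∧ᴴ rel pairing 6 7 2 ∧ᴴ
       rel evaluation 4 1 6 ∧ᴴ rel evaluations 5 1 7)))))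
body below =
  zeroᴴ 2
  ∨ᴴ ∃ᴴ 3 (∃ᴴ 4 (∃ᴴ 5 (∃ᴴ 6 (sucᴴ 3 2 ∧ᴴ rel below 0 1 3 ∧ᴴ rel pairing 3 1 4 ∧ᴴ
       sucᴴ 5 6 ∧ᴴ rel evaluation 0 4 6))))
-- Variable 0 codes the inference checker, variable 1 a list of theorems; variable 2 is a dummy.
body theorems =
  zeroᴴ 1
  ∨ᴴ ∃ᴴ 3 (∃ᴴ 4 (∃ᴴ 5 (∃ᴴ 6 (∃ᴴ 7 (∃ᴴ 8 (∃ᴴ 9 (∃ᴴ 10 (∃ᴴ 11
       -- Variable 6 is the list of premises, 9 codes the vector of 6 and the conclusion 4, and a
       -- positive value 11 means acceptance.
       (sucᴴ 3 1 ∧ᴴ rel pairing 4 5 3 ∧ᴴ rel theorems 0 5 5 ∧ᴴ rel theorems 0 6 6 ∧ᴴ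
        zeroᴴ 7 ∧ᴴ rel pairing 4 7 8 ∧ᴴ rel pairing 6 8 9 ∧ᴴ
        sucᴴ 10 11 ∧ᴴ rel evaluation 0 9 11)))))))))

-- All other variables are bound in a body, so both sides compute to the same type once the symbol
-- is known.
body-args : ∀ s R ρ → ⟪ body s ⟫ R ρ ≡ ⟪ body s ⟫ R (args (ρ 0) (ρ 1) (ρ 2))
body-args pairing     R ρ = refl
body-args nth         R ρ = refl
body-args evaluation  R ρ = refl
body-args evaluations R ρ = refl
body-args below       R ρ = refl
body-args theorems    R ρ = refl

⟪⟫-mono : ∀ p {R R′ : Relations} → (∀ s {a b c} → R s a b c → R′ s a b c) →
  ∀ {ρ} → ⟪ p ⟫ R ρ → ⟪ p ⟫ R′ ρ
⟪⟫-mono (zeroᴴ x)     i h        = h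
⟪⟫-mono (sucᴴ x y)    i h        = h
⟪⟫-mono (rel s x y z) i h        = i s h
⟪⟫-mono (p ∧ᴴ q)      i (h , k)  = ⟪⟫-mono p i h , ⟪⟫-mono q i k
⟪⟫-mono (p ∨ᴴ q)      i (inj₁ h) = inj₁ (⟪⟫-mono p i h)
⟪⟫-mono (p ∨ᴴ q)      i (inj₂ h) = inj₂ (⟪⟫-mono q i h)
⟪⟫-mono (∃ᴴ x p)      i (a , h)  = a , ⟪⟫-mono p i h

Stage : ℕ → Relations
Stage zero    s a b c = ⊥
Stage (suc n) s a b c = ⟪ body s ⟫ (Stage n) (args a b c)

Stage-mono : m ≤ n → ∀ s {a b c} → Stage m s a b c → Stage n s a b c
Stage-mono (s≤s m≤n) s = ⟪⟫-mono (body s) (Stage-mono m≤n)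

Derivable : Relations
Derivable s a b c = ∃ λ n → Stage n s a b c

-- A body is positive and existential, so its truth rests on finitely many tuples, which have all
-- entered at some common stage.
compact : ∀ p {ρ} → ⟪ p ⟫ Derivable ρ → ∃ λ n → ⟪ p ⟫ (Stage n) ρ
compact (zeroᴴ x)     h       = 0 , h
compact (sucᴴ x y)    h       = 0 , h
compact (rel s x y z) h       = h
compact (p ∧ᴴ q)      (h , k)
  with m , h′ ← compact p h | n , k′ ← compact q k
  = m ⊔ n , ⟪⟫-mono p (Stage-mono (m≤m⊔n m n)) h′ , ⟪⟫-mono q (Stage-mono (m≤n⊔m m n)) k′
compact (p ∨ᴴ q)      (inj₁ h) with n , h′ ← compact p h = n , inj₁ h′
compact (p ∨ᴴ q)      (inj₂ h) with n , h′ ← compact q h = n , inj₂ h′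
compact (∃ᴴ x p)      (a , h)  with n , h′ ← compact p h = n , a , h′

derive : ∀ s {a b c} → ⟪ body s ⟫ Derivable (args a b c) → Derivable s a b c
derive s h with n , h′ ← compact (body s) h = suc n , h′

-- The induction principle for derivations: soundness of the clauses reduces to the closure of the
-- intended meanings under them.
Stage-least : (R : Relations) → (∀ s {a b c} → ⟪ body s ⟫ R (args a b c) → R s a b c) →
  ∀ n s {a b c} → Stage n s a b c → R s a b c
Stage-least R closed (suc n) s h = closed s (⟪⟫-mono (body s) (Stage-least R closed n) h)

-- With `pair-zero-suc`, this walks back along Cantor's enumeration; the clause for `pairing`
-- follows that walk, by recursion on the code.
pair-suc : ∀ a b → pair (suc a) b ≡ suc (pair a (suc b))
pair-suc a b = trans (+-suc _ a)
  (cong suc (cong (λ t → triangle t + a) (sym (+-suc a b))))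

pair-zero-suc : ∀ b → pair 0 (suc b) ≡ suc (pair b 0)
pair-zero-suc b = trans (+-identityʳ _)
  (cong suc (trans (+-comm b (triangle b)) (cong (λ t → triangle t + b) (sym (+-identityʳ b)))))

pairing-derivable : ∀ a b → Derivable pairing a b (pair a b)
pairing-derivable a b = go _ a b refl
  where
  go : ∀ c a b → pair a b ≡ c → Derivable pairing a b c
  go zero    zero    zero    eq = derive pairing (inj₁ (refl , refl , refl))
  go (suc c) zero    (suc b) eq = derive pairing (inj₂ (c , b , refl ,
    inj₁ (refl , refl , go c b 0 (suc-injective (trans (sym (pair-zero-suc b)) eq)))))
  go (suc c) (suc a) b       eq = derive pairing (inj₂ (c , a , refl ,
    inj₂ (suc b , refl , refl , go c a (suc b) (suc-injective (trans (sym (pair-suc a b)) eq)))))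
  go zero    zero    (suc b) ()
  go zero    (suc a) b       eq with () ← trans (sym (pair-suc a b)) eq

nth-derivable : (i : Fin n) (xs : Vec ℕ n) → Derivable nth (toℕ i) (codeVec xs) (lookup xs i)
nth-derivable zero    (x ∷ xs) = derive nth (x , codeVec xs , pairing-derivable x _ ,
  inj₁ (refl , pairing-derivable x _))
nth-derivable (suc i) (x ∷ xs) = derive nth (x , codeVec xs , pairing-derivable x _ ,
  inj₂ (toℕ i , refl , nth-derivable i xs))

-- The minimality condition of `mu` in positive form: the earlier values exist and are successors,
-- so no negation enters the clauses.
below-derivable : ∀ k x y →
  (∀ z → z < y → ∃ λ v → Derivable evaluation k (pair z x) (suc v)) → Derivable below k x y
below-derivable k x zero    h = derive below (inj₁ refl)
below-derivable k x (suc y) h with v , p ← h y (n<1+n y) = derive below (inj₂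
  (y , pair y x , v , suc v , refl , below-derivable k x y (λ z z<y → h z (m<n⇒m<1+n z<y)) ,
   pairing-derivable y x , refl , p))

evaluation-derivable : (e : Rec n) → ∀ {xs y} → e [ xs ]⇓ y →
  Derivable evaluation (codeRec e) (codeVec xs) y
evaluations-derivable : (es : Vec (Rec n) m) → ∀ {xs ys} → Pointwise (λ e y → e [ xs ]⇓ y) es ys →
  Derivable evaluations (codeRecs es) (codeVec xs) (codeVec ys)
evaluation-derivable zeroᴿ ⇓zero = derive evaluation (_ , _ , pairing-derivable 0 0 , inj₁ (refl , refl))
evaluation-derivable sucᴿ ⇓suc = derive evaluation (_ , _ , pairing-derivable 1 0 ,
  inj₂ (_ , refl , inj₁ (refl , _ , _ , pairing-derivable _ _ , refl)))
evaluation-derivable (proj i) {xs} (⇓proj _) = derive evaluation (_ , _ , pairing-derivable 2 _ ,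
  inj₂ (_ , refl , inj₂ (_ , refl , inj₁ (refl , nth-derivable i xs))))
evaluation-derivable (comp h es) (⇓comp ps p) = derive evaluation (_ , _ , pairing-derivable 3 _ ,
  inj₂ (_ , refl , inj₂ (_ , refl , inj₂ (_ , refl , inj₁ (refl , _ , _ , _ ,
    pairing-derivable _ _ , evaluations-derivable es ps , evaluation-derivable h p)))))
evaluation-derivable (prec b s) (⇓prec₀ {xs = xs} p) = derive evaluation (_ , _ , pairing-derivable 4 _ ,
  inj₂ (_ , refl , inj₂ (_ , refl , inj₂ (_ , refl , inj₂ (_ , refl , inj₁ (refl , codeRec b , codeRec s , _ , _ ,
    pairing-derivable _ _ , pairing-derivable 0 (codeVec xs) ,
    inj₁ (refl , evaluation-derivable b p)))))))
evaluation-derivable (prec b s) (⇓precₛ {xs = xs} {t} {y} p q) =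
  derive evaluation (_ , _ , pairing-derivable 4 _ ,
  inj₂ (_ , refl , inj₂ (_ , refl , inj₂ (_ , refl , inj₂ (_ , refl , inj₁ (refl , codeRec b , codeRec s , _ , _ ,
    pairing-derivable _ _ , pairing-derivable (suc t) (codeVec xs) ,
    inj₂ (_ , _ , _ , _ , _ , refl , pairing-derivable t (codeVec xs) , evaluation-derivable (prec b s) p ,
      pairing-derivable y (codeVec xs) , pairing-derivable t _ , evaluation-derivable s q)))))))
evaluation-derivable (mu h) {xs} {y} (⇓mu p ps) = derive evaluation (_ , _ , pairing-derivable 5 _ ,
  inj₂ (_ , refl , inj₂ (_ , refl , inj₂ (_ , refl , inj₂ (_ , refl , inj₂ (_ , refl , _ , _ ,
    pairing-derivable y (codeVec xs) , refl , evaluation-derivable h p ,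
    below-derivable _ _ y (λ z z<y → proj₁ (ps z z<y) , evaluation-derivable h (proj₂ (ps z z<y)))))))))
evaluations-derivable []       []       = derive evaluations (inj₁ (refl , refl))
evaluations-derivable (e ∷ es) (p ∷ ps) = derive evaluations (inj₂ (_ , _ , _ , _ , _ , refl ,
  pairing-derivable _ _ , pairing-derivable _ _ , evaluation-derivable e p , evaluations-derivable es ps))

-- Soundness of the Horn clauses

module Meaning (e₀ : Rec 2) (Thm : Formula → Set)
  (closed : ∀ {Γ c v} → All Thm Γ → e₀ [ ⌜ Γ ⌝* ∷ c ∷ [] ]⇓ suc v → ∃ λ φ → ⌜ φ ⌝ ≡ c × Thm φ)
  where

  -- Codes of programs forget arities, so the meanings of evaluation quantify over all programs and
  -- vectors with the given codes. `theorems` is constrained only when its first argument codes the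
  -- checker `e₀`.
  Means : Relations
  Means pairing     a b c = pair a b ≡ c
  Means nth         i x y = ∀ {n} (j : Fin n) xs → toℕ j ≡ i → codeVec xs ≡ x → lookup xs j ≡ y
  Means evaluation  k x y = ∀ {n} (e : Rec n) xs → codeRec e ≡ k → codeVec xs ≡ x → e [ xs ]⇓ y
  Means evaluations k x y = ∀ {n m} (es : Vec (Rec n) m) xs → codeRecs es ≡ k → codeVec xs ≡ x →
    ∃ λ (ys : Vec ℕ m) → codeVec ys ≡ y × Pointwise (λ e y → e [ xs ]⇓ y) es ys
  Means below       k x y = ∀ {n} (h : Rec (suc n)) xs → codeRec h ≡ k → codeVec xs ≡ x →
    ∀ z → z < y → ∃ λ v → h [ z ∷ xs ]⇓ suc v
  Means theorems    k b _ = codeRec e₀ ≡ k → ∃ λ Γ → ⌜ Γ ⌝* ≡ b × All Thm Γ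

  unpair : ∀ a b c d {k} → pair a b ≡ k → pair c d ≡ k → a ≡ c × b ≡ d
  unpair a b c d p q = pair-injective a b c d (trans p (sym q))

  means-closed : ∀ s {a b c} → ⟪ body s ⟫ Means (args a b c) → Means s a b c
  means-closed pairing (inj₁ (refl , refl , refl)) = refl
  means-closed pairing (inj₂ (_ , b , refl , inj₁ (refl , refl , refl))) = pair-zero-suc b
  means-closed pairing (inj₂ (_ , a , refl , inj₂ (b , refl , refl , refl))) = pair-suc a _
  means-closed nth (a , b , _ , inj₁ (refl , p)) zero (x ∷ xs) refl q = proj₁ (unpair x (codeVec xs) _ b q p)
  means-closed nth (a , b , p , inj₂ (_ , refl , ih)) (suc j) (x ∷ xs) refl q
    with refl , refl ← unpair a b x (codeVec xs) p q = ih j xs refl refl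
  means-closed evaluation (r , t , p , h) zeroᴿ xs q refl
    with refl , refl ← unpair t r 0 0 p q | h
  ... | inj₁ (_ , refl) = ⇓zero
  means-closed evaluation (r , t , p , h) sucᴿ (x ∷ []) q refl
    with refl , refl ← unpair t r 1 0 p q | h
  ... | inj₂ (_ , refl , inj₁ (_ , a , b , u , refl))
    with refl , _ ← pair-injective a b x 0 u = ⇓suc
  means-closed evaluation {c = y} (r , t , p , h) (proj i) xs q refl
    with refl , refl ← unpair t r 2 (toℕ i) p q | h
  ... | inj₂ (_ , refl , inj₂ (_ , refl , inj₁ (_ , u))) =
    subst (proj i [ xs ]⇓_) (u i xs refl refl) (⇓proj i)
  means-closed evaluation (r , t , p , h) (comp e es) xs q refl
    with refl , refl ← unpair t r 3 (pair (codeRec e) (codeRecs es)) p q | h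
  ... | inj₂ (_ , refl , inj₂ (_ , refl , inj₂ (_ , refl , inj₁ (_ , a , b , _ , u , ihs , ih))))
    with refl , refl ← pair-injective a b (codeRec e) (codeRecs es) u
    with ys , v , ps ← ihs es xs refl refl = ⇓comp ps (ih e ys refl v)
  means-closed evaluation (r , t , p , h) (prec b s) (t₀ ∷ xs) q refl
    with refl , refl ← unpair t r 4 (pair (codeRec b) (codeRec s)) p q | h
  ... | inj₂ (_ , refl , inj₂ (_ , refl , inj₂ (_ , refl , inj₂ (_ , refl ,
          inj₁ (_ , a , a′ , c , c′ , u , u′ , cases)))))
    with refl , refl ← pair-injective a a′ (codeRec b) (codeRec s) u
       | refl , refl ← pair-injective c c′ t₀ (codeVec xs) u′
       | cases
  ... | inj₁ (refl , ih) = ⇓prec₀ (ih b xs refl refl)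
  ... | inj₂ (t′ , _ , y , _ , _ , refl , u , ih , v , v′ , ih′) =
    ⇓precₛ (ih (prec b s) (t′ ∷ xs) q u)
           (ih′ s (t′ ∷ y ∷ xs) refl (trans (cong (pair t′) v) v′))
  means-closed evaluation {c = y} (r , t , p , h) (mu e) xs q refl
    with refl , refl ← unpair t r 5 (codeRec e) p q | h
  ... | inj₂ (_ , refl , inj₂ (_ , refl , inj₂ (_ , refl , inj₂ (_ , refl , inj₂ (_ , refl ,
          _ , _ , u , refl , ih , ih′))))) =
    ⇓mu (ih e (y ∷ xs) refl u) (ih′ e xs refl refl)
  means-closed evaluations (inj₁ (refl , refl)) [] xs _ _ = [] , refl , []
  means-closed evaluations (inj₂ (_ , a , b , y , _ , refl , p , r , ih , ihs)) (e ∷ es) xs refl q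
    with refl , refl ← pair-injective a b (codeRec e) (codeRecs es) p
    with ys , v , ps ← ihs es xs refl q
    = y ∷ ys , trans (cong (pair y) v) r , ih e xs refl q ∷ ps
  means-closed below (inj₁ refl) e xs p q z ()
  means-closed below (inj₂ (y′ , _ , v , _ , refl , ih , r , refl , ih′)) e xs p refl z z<y
    with m<1+n⇒m<n∨m≡n z<y
  ... | inj₁ z<y′ = ih e xs p refl z z<y′
  ... | inj₂ refl = v , ih′ e (z ∷ xs) p r
  means-closed theorems (inj₁ refl) _ = [] , refl , []
  means-closed theorems (inj₂ (_ , c , _ , _ , _ , _ , _ , _ , _ ,
      refl , p , ih , ih′ , refl , q , r , refl , ih″)) k
    with Γ , refl , hs ← ih k
       | Δ , refl , hs′ ← ih′ k
    with φ , refl , h ← closed hs′ (ih″ e₀ (⌜ Δ ⌝* ∷ c ∷ []) k (trans (cong (pair ⌜ Δ ⌝*) q) r))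
    = φ ∷ Γ , cong suc p , h ∷ hs

-- A single inference checker for a formal system

module _ (S : FormalSystem) where
  open FormalSystem S

  -- Axioms count as an additional rule, whose decider ignores the premises.
  deciders : Fin (suc #rules) → Rec 2
  deciders zero    = comp (proj₁ Axiom-dec) (proj (suc zero) ∷ [])
  deciders (suc i) = proj₁ (rule-dec i)

  deciders-total : ∀ i {b c} → ∃ λ v → deciders i [ b ∷ c ∷ [] ]⇓ v
  deciders-total zero {c = c} with proj₂ Axiom-dec (c ∷ [])
  ... | inj₁ (_ , p) = 1 , ⇓comp (⇓proj (suc zero) ∷ []) p
  ... | inj₂ (_ , p) = 0 , ⇓comp (⇓proj (suc zero) ∷ []) p
  deciders-total (suc i) {b} {c} with proj₂ (rule-dec i) (b ∷ c ∷ [])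
  ... | inj₁ (_ , p) = 1 , p
  ... | inj₂ (_ , p) = 0 , p

  -- Opaque, because codes of concrete programs are too large to be computed.
  opaque
    inferenceᴿ : Rec 2
    inferenceᴿ = sumᴿ (suc #rules) deciders

    ⇓inference : ∀ i {b c u} → deciders i [ b ∷ c ∷ [] ]⇓ suc u →
      ∃ λ v → inferenceᴿ [ b ∷ c ∷ [] ]⇓ suc v
    ⇓inference i p = ⇓sum-positive _ deciders (λ j → deciders-total j) i p

    ⇓inference⁻¹ : ∀ {b c v} → inferenceᴿ [ b ∷ c ∷ [] ]⇓ suc v →
      ∃ λ i → ∃ λ u → deciders i [ b ∷ c ∷ [] ]⇓ suc u
    ⇓inference⁻¹ p = ⇓sum-positive⁻¹ _ deciders p

  recursive-accepts : ∀ {A : Vec ℕ n → Set} (dec : Recursive A) {xs} → A xs → proj₁ dec [ xs ]⇓ 1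
  recursive-accepts (e , dec) {xs} a with dec xs
  ... | inj₁ (_ , p)  = p
  ... | inj₂ (¬a , _) = ⊥-elim (¬a a)

  recursive-sound : ∀ {A : Vec ℕ n → Set} (dec : Recursive A) {xs v} → proj₁ dec [ xs ]⇓ suc v → A xs
  recursive-sound (e , dec) {xs} p with dec xs
  ... | inj₁ (a , _) = a
  ... | inj₂ (_ , q) with () ← ⇓-deterministic e p q

  inference-sound : ∀ {Γ c v} → All (Theorem S) Γ → inferenceᴿ [ ⌜ Γ ⌝* ∷ c ∷ [] ]⇓ suc v →
    ∃ λ φ → ⌜ φ ⌝ ≡ c × Theorem S φ
  inference-sound {Γ} hs p with ⇓inference⁻¹ p
  ... | zero , _ , ⇓comp (⇓proj _ ∷ []) q
    with φ , eq , a ← recursive-sound Axiom-dec q = φ , eq , axiom a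
  ... | suc i , _ , q
    with Δ , φ , eq , eq′ , r ← recursive-sound (rule-dec i) q
    with refl ← ⌜⌝*-injective Δ Γ eq = φ , eq′ , infer i r hs

  -- Simultaneous induction on proofs and lists of proofs: `b` codes the premises of the last
  -- inference.
  theorem-derivable : ∀ {φ} → Theorem S φ → ∃ λ b → ∃ λ v →
    Derivable theorems (codeRec inferenceᴿ) b b × inferenceᴿ [ b ∷ ⌜ φ ⌝ ∷ [] ]⇓ suc v
  theorems-derivable : ∀ {Γ} c → All (Theorem S) Γ →
    Derivable theorems (codeRec inferenceᴿ) ⌜ Γ ⌝* c
  theorem-derivable (axiom a)
    -- For an axiom any premises will do; 0 codes the empty list.
    with v , p ← ⇓inference zero {b = 0}
           (⇓comp (⇓proj (suc zero) ∷ []) (recursive-accepts Axiom-dec (_ , refl , a)))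
    = 0 , v , derive theorems (inj₁ refl) , p
  theorem-derivable (infer i {Γ} r hs)
    with v , p ← ⇓inference (suc i)
           (recursive-accepts (rule-dec i) (Γ , _ , refl , refl , r))
    = ⌜ Γ ⌝* , v , theorems-derivable _ hs , p
  theorems-derivable c []       = derive theorems (inj₁ refl)
  theorems-derivable c (_∷_ {x = φ} {xs = Γ} h hs)
    with b , v , d , p ← theorem-derivable h
    = derive theorems (inj₂ (pair ⌜ φ ⌝ ⌜ Γ ⌝* , ⌜ φ ⌝ , ⌜ Γ ⌝* , b , 0 , pair ⌜ φ ⌝ 0 , pair b (pair ⌜ φ ⌝ 0) ,
        v , suc v , refl , pairing-derivable _ _ , theorems-derivable _ hs , d , refl ,
        pairing-derivable ⌜ φ ⌝ 0 , pairing-derivable b (pair ⌜ φ ⌝ 0) , refl ,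
        evaluation-derivable inferenceᴿ p))

-- Axioms for the natural numbers

infixr 8 _∧_
infixr 7 _∨_

_∧_ _∨_ : Formula → Formula → Formula
φ ∧ ψ = neg (φ ⇒ neg ψ)
φ ∨ ψ = neg φ ⇒ ψ

ex : Var → Formula → Formula
ex x φ = neg (all x (neg φ))

worldF zeroF : Var → Formula
zeroF  x = atom 1 0 (x ∷ [])
worldF x = atom 1 1 (x ∷ [])

-- There is no identity symbol, so `eqF` is an ordinary predicate. The axioms ensure that
-- individuals related by it stand for the same number.
sucF eqF : Var → Var → Formula
sucF x y = atom 2 0 (x ∷ y ∷ [])
eqF  x y = atom 2 1 (x ∷ y ∷ [])

codeSymbol : Symbol → ℕ
codeSymbol pairing     = 0
codeSymbol nth         = 1
codeSymbol evaluation  = 2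
codeSymbol evaluations = 3
codeSymbol below       = 4
codeSymbol theorems    = 5

relF : Symbol → Var → Var → Var → Var → Formula
relF s n x y z = atom 4 (codeSymbol s) (n ∷ x ∷ y ∷ z ∷ [])

-- The stage is kept in variable 0.
compile : Body → Formula
compile (zeroᴴ x)     = zeroF (suc x)
compile (sucᴴ x y)    = sucF (suc x) (suc y)
compile (rel s x y z) = relF s 0 (suc x) (suc y) (suc z)
compile (p ∧ᴴ q)      = compile p ∧ compile q
compile (p ∨ᴴ q)      = compile p ∨ compile q
compile (∃ᴴ x p)      = ex (suc x) (compile p)

-- Only the direction from tuples to justifications is demanded: it bounds the relations from above,
-- which suffices since the diagonal sentence denies that certain tuples exist.
clause : Symbol → Formula
clause s = all 1 (all 2 (all 3 (all 4 (relF s 4 1 2 3 ⇒ ex 0 (sucF 0 4 ∧ compile (body s))))))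

-- The consequent in `worldsF` is a contradiction, so the negated conditional says that some world
-- is selected: each individual has an accessible world.
worldsF predecessorF descentF reflexiveF injectiveF zeroˡF zeroʳF : Formula
worldsF      = all 0 (neg (worldF 0 > neg (worldF 0 ⇒ worldF 0)))
predecessorF = all 0 (zeroF 0 ∨ ex 1 (sucF 1 0))
-- The first accessible world of 0 or 1 is not one of 0, so that predecessors go down in the
-- well-order of the accessible worlds.
descentF     = all 0 (all 1 (sucF 1 0 ⇒ neg ((worldF 0 ∨ worldF 1) > worldF 0)))
reflexiveF   = all 0 (eqF 0 0)
injectiveF   = all 0 (all 1 (all 2 (all 3 (eqF 0 1 ⇒ sucF 2 0 ⇒ sucF 3 1 ⇒ eqF 2 3))))
zeroˡF       = all 0 (all 1 (all 2 (eqF 0 1 ⇒ zeroF 0 ⇒ neg (sucF 2 1))))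
zeroʳF       = all 0 (all 1 (all 2 (eqF 0 1 ⇒ sucF 2 0 ⇒ neg (zeroF 1))))

axioms : List Formula
axioms = worldsF ∷ predecessorF ∷ descentF ∷ reflexiveF ∷ injectiveF ∷ zeroˡF ∷ zeroʳF ∷
  clause pairing ∷ clause nth ∷ clause evaluation ∷ clause evaluations ∷ clause below ∷
  clause theorems ∷ []

-- stepF φ says φ of the successor of variable 0, and letF k φ says φ of the number k;
-- variable 1 is overwritten.
stepF : Formula → Formula
stepF φ = all 1 (eqF 0 1 ⇒ all 0 (sucF 1 0 ⇒ φ))

stepsF : ℕ → Formula → Formula
stepsF zero    φ = φ
stepsF (suc k) φ = stepF (stepsF k φ)

letF : ℕ → Formula → Formula
letF k φ = all 0 (zeroF 0 ⇒ stepsF k φ)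

infixr 6 _⇛_
_⇛_ : List Formula → Formula → Formula
Γ ⇛ φ = foldr _⇒_ φ Γ

module Semantics (em : ExcludedMiddle 0ℓ) {F : SelectionFrame} (M : Model F) where
  open SelectionFrame F
  open Model M

  dne : {A : Set} → ¬ ¬ A → A
  dne = decidable-stable em

  ∧-elim : ∀ φ ψ {g w} → ⟦ M ⟧ (φ ∧ ψ) g w → ⟦ M ⟧ φ g w × ⟦ M ⟧ ψ g w
  ∧-elim φ ψ h = dne λ ¬φψ → h λ p q → ¬φψ (p , q)

  ∨-elim : ∀ φ ψ {g w} → ⟦ M ⟧ (φ ∨ ψ) g w → ⟦ M ⟧ φ g w ⊎ ⟦ M ⟧ ψ g w
  ∨-elim φ ψ {g} {w} h with em {⟦ M ⟧ φ g w}
  ... | yes p = inj₁ p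
  ... | no ¬p = inj₂ (h ¬p)

  ex-elim : ∀ x φ {g w} → ⟦ M ⟧ (ex x φ) g w → ∃ λ a → a ∈ d w × ⟦ M ⟧ φ (g [ x ≔ a ]) w
  ex-elim x φ h = dne λ ¬∃ → h λ a a∈ p → ¬∃ (a , a∈ , p)

  ⇛-elim : ∀ Γ {φ g w} → ⟦ M ⟧ (Γ ⇛ φ) g w → All (λ ψ → ⟦ M ⟧ ψ g w) Γ → ⟦ M ⟧ φ g w
  ⇛-elim []      h []       = h
  ⇛-elim (ψ ∷ Γ) h (p ∷ ps) = ⇛-elim Γ (h p) ps

  ⇛-intro : ∀ Γ {φ g w} → (All (λ ψ → ⟦ M ⟧ ψ g w) Γ → ⟦ M ⟧ φ g w) → ⟦ M ⟧ (Γ ⇛ φ) g w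
  ⇛-intro []      h   = h []
  ⇛-intro (ψ ∷ Γ) h p = ⇛-intro Γ (λ ps → h (p ∷ ps))

-- Models of the axioms contain only standard numbers

module Standardness (em : ExcludedMiddle 0ℓ) {F : SelectionFrame} (stal : Stalnakerian F)
  (M : Model F) (w : SelectionFrame.W F) (g : Var → SelectionFrame.D F)
  (worlds : ⟦ M ⟧ worldsF g w) (predecessor : ⟦ M ⟧ predecessorF g w)
  (descent : ⟦ M ⟧ descentF g w) (reflexive : ⟦ M ⟧ reflexiveF g w)
  (injective : ⟦ M ⟧ injectiveF g w) (zeroˡ : ⟦ M ⟧ zeroˡF g w) (zeroʳ : ⟦ M ⟧ zeroʳF g w)
  (clauses : ∀ s → ⟦ M ⟧ (clause s) g w) where
  open SelectionFrame F
  open Stalnakerian stal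
  open Model M
  open Semantics em M

  World : D → Pred W 0ℓ
  World a v = I 1 1 v (a ∷ [])

  Zero : D → Set
  Zero a = I 1 0 w (a ∷ [])

  Suc Eq : D → D → Set
  Suc a b = I 2 0 w (a ∷ b ∷ [])
  Eq  a b = I 2 1 w (a ∷ b ∷ [])

  Either : D → D → Pred W 0ℓ
  Either a b v = ¬ World a v → World b v

  world-selected : ∀ {a} → a ∈ d w → ∃ λ v → World a v × R w v
  world-selected {a} a∈ = dne λ ¬∃ →
    worlds a a∈ λ {v} v∈f → ⊥-elim (¬∃ (v , success (World a) w v∈f , f⊆R (World a) w v∈f))

  -- The world selected for the set `P` of all worlds of members of `X` belongs to some member `a`.
  -- It is selected again when `a` competes with only one other member.
  least : (X : Pred D 0ℓ) → X ⊆ d w → ∃ X → ∃ λ a → X a × (∀ b → X b → f (Either a b) w ⊆ World a)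
  least X X⊆d (a₀ , a₀∈X) = a , a∈X , below-all
    where
    P : Pred W 0ℓ
    P v = ∃ λ b → X b × World b v

    selected : ∃ λ v → f P w v
    selected = dne λ ¬∃ → let u , a₀u , Rwu = world-selected (X⊆d a₀∈X) in
      vacuity P w (λ v v∈f → ¬∃ (v , v∈f)) u ((a₀ , a₀∈X , a₀u) , Rwu)

    v : W
    v = proj₁ selected
    a : D
    a = proj₁ (success P w (proj₂ selected))
    a∈X : X a
    a∈X = proj₁ (proj₂ (success P w (proj₂ selected)))
    av : World a v
    av = proj₂ (proj₂ (success P w (proj₂ selected)))

    below-all : ∀ b → X b → f (Either a b) w ⊆ World a
    below-all b b∈X {u} u∈f =
      subst (World a) (uniqueness P w (proj₂ selected) (proj₂ same u∈f)) av
      where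
      ⊆Either : f P w ⊆ Either a b
      ⊆Either u∈ ¬au = ⊥-elim (¬au (subst (World a) (uniqueness P w (proj₂ selected) u∈) av))
      ⊆P : f (Either a b) w ⊆ P
      ⊆P {u} u∈ with em {World a u}
      ... | yes au = a , a∈X , au
      ... | no ¬au = b , b∈X , success (Either a b) w u∈ ¬au
      -- Reciprocity makes selection from the two candidates agree with selection from all of `P`.
      same = reciprocity P (Either a b) w ⊆Either ⊆P

  data Numbers : D → ℕ → Set where
    zero : ∀ {a} → Zero a → Numbers a 0
    suc  : ∀ {a b n} → b ∈ d w → Suc b a → Numbers b n → Numbers a (suc n)

  -- Predecessors of one individual may be distinct and are only known to be related by `Eq`, so the
  -- induction has to run over `Eq`-related pairs.
  numbers-unique : ∀ {a b m n} → a ∈ d w → b ∈ d w → Eq a b → Numbers a m → Numbers b n → m ≡ n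
  numbers-unique a∈ b∈ e (zero _) (zero _) = refl
  numbers-unique a∈ b∈ e (zero z) (suc c∈ s _) =
    ⊥-elim (zeroˡ _ a∈ _ b∈ _ c∈ e z s)
  numbers-unique a∈ b∈ e (suc c∈ s _) (zero z) =
    ⊥-elim (zeroʳ _ a∈ _ b∈ _ c∈ e s z)
  numbers-unique a∈ b∈ e (suc c∈ s p) (suc c′∈ s′ q) =
    cong suc (numbers-unique c∈ c′∈ (injective _ a∈ _ b∈ _ c∈ _ c′∈ e s s′) p q)

  -- Otherwise a least individual without a number exists. It is not a zero, its predecessor has no
  -- number either, and `descent` contradicts leastness.
  numbered : ∀ {a} → a ∈ d w → ∃ (Numbers a)
  numbered {a} a∈ = dne λ ¬∃ → absurd (least X proj₁ (a , a∈ , ¬∃))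
    where
    X : Pred D 0ℓ
    X b = b ∈ d w × ¬ ∃ (Numbers b)
    absurd : ¬ ∃ λ a → X a × (∀ b → X b → f (Either a b) w ⊆ World a)
    absurd (a , (a∈ , ¬num) , a≼)
      with ∨-elim (zeroF 0) (ex 1 (sucF 1 0)) {g [ 0 ≔ a ]} (predecessor a a∈)
    ... | inj₁ z = ¬num (0 , zero z)
    ... | inj₂ h with b , b∈ , s ← ex-elim 1 (sucF 1 0) {g [ 0 ≔ a ]} h
      = descent a a∈ b b∈ s (a≼ b (b∈ , λ (n , num) → ¬num (suc n , suc b∈ s num)))

  -- By `numbered`, the default 0 is never taken on `d w`.
  number : D → ℕ
  number a with em {∃ (Numbers a)}
  ... | yes (n , _) = n
  ... | no _        = 0

  numbers-number : ∀ {a} → a ∈ d w → Numbers a (number a)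
  numbers-number {a} a∈ with em {∃ (Numbers a)}
  ... | yes (_ , h) = h
  ... | no ¬num     = ⊥-elim (¬num (numbered a∈))

  number-unique : ∀ {a n} → a ∈ d w → Numbers a n → number a ≡ n
  number-unique a∈ =
    numbers-unique a∈ a∈ (reflexive _ a∈) (numbers-number a∈)

  number-zero : ∀ {a} → a ∈ d w → Zero a → number a ≡ 0
  number-zero a∈ z = number-unique a∈ (zero z)

  number-suc : ∀ {a b} → a ∈ d w → b ∈ d w → Suc a b → number b ≡ suc (number a)
  number-suc a∈ b∈ s = number-unique b∈ (suc a∈ s (numbers-number a∈))

  number-eq : ∀ {a b} → a ∈ d w → b ∈ d w → Eq a b → number a ≡ number b
  number-eq a∈ b∈ e = numbers-unique a∈ b∈ e (numbers-number a∈) (numbers-number b∈)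

  -- A clause is closed. This allows `g`, which may leave the local domain, to be replaced by an
  -- assignment into `d w`.
  clause-holds : ∀ s h → ⟦ M ⟧ (clause s) h w
  clause-holds pairing     h = clauses pairing
  clause-holds nth         h = clauses nth
  clause-holds evaluation  h = clauses evaluation
  clause-holds evaluations h = clauses evaluations
  clause-holds below       h = clauses below
  clause-holds theorems    h = clauses theorems

  update-∈ : ∀ {h : Var → D} {x a} → (∀ y → h y ∈ d w) → a ∈ d w → ∀ y → (h [ x ≔ a ]) y ∈ d w
  update-∈ {x = x} h∈ a∈ y with does (y ≟ x)
  ... | true  = a∈
  ... | false = h∈ y

  compile-sound : ∀ p {h ρ} {R : Relations} → (∀ x → h x ∈ d w) → (∀ x → ρ x ≡ number (h (suc x))) →
    (∀ s {a b c} → a ∈ d w → b ∈ d w → c ∈ d w → I 4 (codeSymbol s) w (h 0 ∷ a ∷ b ∷ c ∷ []) →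
      R s (number a) (number b) (number c)) →
    ⟦ M ⟧ (compile p) h w → ⟪ p ⟫ R ρ
  compile-sound (zeroᴴ x) h∈ eq rs p = trans (eq x) (number-zero (h∈ _) p)
  compile-sound (sucᴴ x y) h∈ eq rs p =
    trans (eq y) (trans (number-suc (h∈ _) (h∈ _) p) (cong suc (sym (eq x))))
  compile-sound (rel s x y z) h∈ eq rs p rewrite eq x | eq y | eq z = rs s (h∈ _) (h∈ _) (h∈ _) p
  compile-sound (p ∧ᴴ q) h∈ eq rs r with r₁ , r₂ ← ∧-elim (compile p) (compile q) r =
    compile-sound p h∈ eq rs r₁ , compile-sound q h∈ eq rs r₂
  compile-sound (p ∨ᴴ q) h∈ eq rs r with ∨-elim (compile p) (compile q) r
  ... | inj₁ r₁ = inj₁ (compile-sound p h∈ eq rs r₁)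
  ... | inj₂ r₂ = inj₂ (compile-sound q h∈ eq rs r₂)
  compile-sound (∃ᴴ x p) {h} {ρ} h∈ eq rs r with a , a∈ , r′ ← ex-elim (suc x) (compile p) r =
    number a , compile-sound p (update-∈ h∈ a∈) eq′ rs r′
    where
    eq′ : ∀ y → (ρ [ x ≔ number a ]) y ≡ number ((h [ suc x ≔ a ]) (suc y))
    eq′ y with does (y ≟ x)
    ... | true  = refl
    ... | false = eq y

  -- Induction on the stage: the clause supplies a predecessor of `k`, at which the justifying
  -- tuples have entered.
  rel-sound : ∀ n s {k a b c} → k ∈ d w → a ∈ d w → b ∈ d w → c ∈ d w → number k ≡ n →
    I 4 (codeSymbol s) w (k ∷ a ∷ b ∷ c ∷ []) → Stage n s (number a) (number b) (number c)
  rel-sound n s {k} {a} {b} {c} k∈ a∈ b∈ c∈ eq r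
    with j , j∈ , p ← ex-elim 0 (sucF 0 4 ∧ compile (body s)) (clause-holds s (λ _ → k) a a∈ b b∈ c c∈ k k∈ r)
    with p₁ , p₂ ← ∧-elim (sucF 0 4) (compile (body s)) p
    -- Stage 0 is excluded, since `k` has a predecessor.
    with n | trans (sym eq) (number-suc j∈ k∈ p₁)
  ... | suc n | eq′ = subst (λ A → A) (body-args s (Stage n) ρ) (compile-sound (body s) h∈ (λ _ → refl)
        (λ s a∈ b∈ c∈ → rel-sound n s j∈ a∈ b∈ c∈ (sym (suc-injective eq′))) p₂)
    where
    h = (((((λ _ → k) [ 1 ≔ a ]) [ 2 ≔ b ]) [ 3 ≔ c ]) [ 4 ≔ k ]) [ 0 ≔ j ]
    ρ : Var → ℕ
    ρ x = number (h (suc x))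
    h∈ : ∀ x → h x ∈ d w
    h∈ = update-∈ (update-∈ (update-∈ (update-∈ (update-∈ (λ _ → k∈) a∈) b∈) c∈) k∈) j∈

  -- Only variables 0 and 1 are overwritten, so parameters are safe from variable 2 on.
  stepsF-intro : ∀ k φ {h} → h 0 ∈ d w →
    (∀ h′ → (∀ x → h′ (2 + x) ≡ h (2 + x)) → h′ 0 ∈ d w → number (h′ 0) ≡ number (h 0) + k →
      ⟦ M ⟧ φ h′ w) →
    ⟦ M ⟧ (stepsF k φ) h w
  stepsF-intro zero    φ h∈ p = p _ (λ _ → refl) h∈ (sym (+-identityʳ _))
  stepsF-intro (suc k) φ {h} h∈ p b b∈ e a a∈ s = stepsF-intro k φ a∈ λ h′ same h′∈ eq →
    p h′ same h′∈ (trans eq (trans (cong (_+ k) (number-suc b∈ a∈ s))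
      (trans (cong (λ i → suc i + k) (sym (number-eq h∈ b∈ e))) (sym (+-suc _ k)))))

  -- The axioms assert the existence of no number; where `k` is missing, the universal form of
  -- `letF` makes it vacuously true.
  letF-intro : ∀ k φ {h} →
    (∀ h′ → (∀ x → h′ (2 + x) ≡ h (2 + x)) → h′ 0 ∈ d w → number (h′ 0) ≡ k → ⟦ M ⟧ φ h′ w) →
    ⟦ M ⟧ (letF k φ) h w
  letF-intro k φ p a a∈ z = stepsF-intro k φ a∈ λ h′ same h′∈ eq →
    p h′ same h′∈ (trans eq (cong (_+ k) (number-zero a∈ z)))

-- The standard model

module Standard (em : ExcludedMiddle 0ℓ) where

  First : Pred ℕ 0ℓ → ℕ → Pred ℕ 0ℓ
  First P w v = P v × w ≤ v × (∀ u → P u → w ≤ u → v ≤ u)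

  first-exists : ∀ P w {u} → P u → w ≤ u → ∃ (First P w)
  first-exists P w {u} = <-rec (λ u → P u → w ≤ u → ∃ (First P w)) step u
    where
    step : ∀ u → (∀ {v} → v < u → P v → w ≤ v → ∃ (First P w)) → P u → w ≤ u → ∃ (First P w)
    step u ih pu w≤u with em {∃ λ v → v < u × P v × w ≤ v}
    ... | yes (v , v<u , pv , w≤v) = ih v<u pv w≤v
    ... | no ¬smaller = u , pu , w≤u , λ v pv w≤v → ≮⇒≥ λ v<u → ¬smaller (v , v<u , pv , w≤v)

  frame : SelectionFrame
  frame = record
    { W      = ℕ
    ; W-elem = 0
    ; R      = _≤_
    ; f      = First
    ; D      = ℕ
    ; D-elem = 0
    ; d      = λ _ _ → ⊤
    ; f-cong = λ w (P⊆Q , Q⊆P) →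
        (λ (p , w≤v , min) → P⊆Q p , w≤v , λ u q → min u (Q⊆P q)) ,
        (λ (q , w≤v , min) → Q⊆P q , w≤v , λ u p → min u (P⊆Q p))
    ; f⊆R    = λ P w (_ , w≤v , _) → w≤v
    }

  frame-stalnakerian : Stalnakerian frame
  frame-stalnakerian = record
    { success     = λ P w → proj₁
    ; centering   = λ P w p → p , ≤-refl , λ u _ w≤u → w≤u
    ; vacuity     = λ P w empty v (p , w≤v) →
        let u , first = first-exists P w p w≤v in empty u first
    ; reciprocity = λ P Q w P⊆ Q⊆ → transfer P Q w P⊆ Q⊆ , transfer Q P w Q⊆ P⊆
    ; uniqueness  = λ P w (p , w≤x , min) (q , w≤y , min′) → ≤-antisym (min _ q w≤y) (min′ _ p w≤x)
    }
    where
    transfer : ∀ P Q w → First P w ⊆ Q → First Q w ⊆ P → First P w ⊆ First Q w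
    transfer P Q w P⊆ Q⊆ {v} first@(p , w≤v , min) = P⊆ first , w≤v , λ u q w≤u →
      let v′ , first′@(_ , w≤v′ , min′) = first-exists Q w q w≤u in
      ≤-trans (min v′ (Q⊆ first′) w≤v′) (min′ u q w≤u)

  decodeSymbol : ℕ → Symbol
  decodeSymbol 0 = pairing
  decodeSymbol 1 = nth
  decodeSymbol 2 = evaluation
  decodeSymbol 3 = evaluations
  decodeSymbol 4 = below
  decodeSymbol _ = theorems

  decodeSymbol-codeSymbol : ∀ s → decodeSymbol (codeSymbol s) ≡ s
  decodeSymbol-codeSymbol pairing     = refl
  decodeSymbol-codeSymbol nth         = refl
  decodeSymbol-codeSymbol evaluation  = refl
  decodeSymbol-codeSymbol evaluations = refl
  decodeSymbol-codeSymbol below       = refl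
  decodeSymbol-codeSymbol theorems    = refl

  -- The number `a` is attached to the world `a` alone. The axioms are evaluated at world 0, from
  -- which every world is accessible.
  interpretation : (n i : ℕ) → ℕ → Pred (Vec ℕ n) 0ℓ
  interpretation 1 0 w (a ∷ [])             = a ≡ 0
  interpretation 1 1 w (a ∷ [])             = a ≡ w
  interpretation 2 0 w (a ∷ b ∷ [])         = b ≡ suc a
  interpretation 2 1 w (a ∷ b ∷ [])         = a ≡ b
  interpretation 4 i w (n ∷ a ∷ b ∷ c ∷ []) = Stage n (decodeSymbol i) a b c
  interpretation _ _ w as                   = ⊥

  model : Model frame
  model = record { I = interpretation }

  compile-complete : ∀ p {h ρ} → (∀ x → h (suc x) ≡ ρ x) →
    ⟪ p ⟫ (Stage (h 0)) ρ → ⟦ model ⟧ (compile p) h 0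
  compile-complete (zeroᴴ x) eq p = trans (eq x) p
  compile-complete (sucᴴ x y) eq p = trans (eq y) (trans p (cong suc (sym (eq x))))
  compile-complete (rel s x y z) eq p
    rewrite eq x | eq y | eq z | decodeSymbol-codeSymbol s = p
  compile-complete (p ∧ᴴ q) eq (r₁ , r₂) h = h (compile-complete p eq r₁) (compile-complete q eq r₂)
  compile-complete (p ∨ᴴ q) eq (inj₁ r) ¬p = ⊥-elim (¬p (compile-complete p eq r))
  compile-complete (p ∨ᴴ q) eq (inj₂ r) ¬p = compile-complete q eq r
  compile-complete (∃ᴴ x p) {h} {ρ} eq (a , r) h′ = h′ a tt (compile-complete p eq′ r)
    where
    eq′ : ∀ y → (h [ suc x ≔ a ]) (suc y) ≡ (ρ [ x ≔ a ]) y
    eq′ y with does (y ≟ x)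
    ... | true  = refl
    ... | false = eq y

  clause-true : ∀ s h → ⟦ model ⟧ (clause s) h 0
  clause-true s h a _ b _ c _ n _ r with n | subst (λ s → Stage n s a b c) (decodeSymbol-codeSymbol s) r
  ... | suc n | r′ = λ absurd → absurd n tt λ ¬p → ¬p refl
    (compile-complete (body s) (λ _ → refl) (subst (λ A → A) (sym (body-args s (Stage n) _)) r′))

  axioms-true : ∀ h → All (λ φ → ⟦ model ⟧ φ h 0) axioms
  axioms-true h =
    (λ a _ empty → let v , first = first-exists (λ v → a ≡ v) 0 refl z≤n in empty first (λ p → p)) ∷
    (λ { zero _ ¬zero → ⊥-elim (¬zero refl) ; (suc a) _ _ ¬suc → ¬suc a tt refl }) ∷
    -- The first world of `suc b` or `b` is `b`, which is not one of `suc b`.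
    (λ { a _ b _ refl selected → 1+n≢n (selected (first b)) }) ∷
    (λ _ _ → refl) ∷
    (λ { a _ b _ c _ e _ refl s s′ → suc-injective (trans (sym s) s′) }) ∷
    (λ { a _ b _ c _ refl refl () }) ∷
    (λ { a _ b _ c _ refl refl () }) ∷
    clause-true pairing h ∷ clause-true nth h ∷ clause-true evaluation h ∷
    clause-true evaluations h ∷ clause-true below h ∷ clause-true theorems h ∷ []
    where
    first : ∀ b → First (λ v → ¬ suc b ≡ v → b ≡ v) 0 b
    first b = (λ _ → refl) , z≤n , λ u p _ → decide u p
      where
      decide : ∀ u → (¬ suc b ≡ u → b ≡ u) → b ≤ u
      decide u p with suc b ≟ u
      ... | yes refl = n≤1+n b
      ... | no b≢u   = ≤-reflexive (p b≢u)

  -- Here all successors exist, so the universal quantifiers can be instantiated.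
  stepsF-elim : ∀ k φ {h} → ⟦ model ⟧ (stepsF k φ) h 0 →
    ∃ λ h′ → (∀ x → h′ (2 + x) ≡ h (2 + x)) × h′ 0 ≡ h 0 + k × ⟦ model ⟧ φ h′ 0
  stepsF-elim zero    φ {h} p = h , (λ _ → refl) , sym (+-identityʳ _) , p
  stepsF-elim (suc k) φ {h} p
    with h′ , same , eq , q ← stepsF-elim k φ (p (h 0) tt refl (suc (h 0)) tt refl)
    = h′ , same , trans eq (sym (+-suc _ k)) , q

  letF-elim : ∀ k φ {h} → ⟦ model ⟧ (letF k φ) h 0 →
    ∃ λ h′ → (∀ x → h′ (2 + x) ≡ h (2 + x)) × h′ 0 ≡ k × ⟦ model ⟧ φ h′ 0
  letF-elim k φ p = stepsF-elim k φ (p 0 tt refl)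

-- The diagonal sentence

-- A record, so that formulas are compared without computing their codes.
record _[_]⇓⌜_⌝ {n : ℕ} (e : Rec n) (xs : Vec ℕ n) (φ : Formula) : Set where
  constructor ⌜_⌝⇓
  field
    computes : e [ xs ]⇓ ⌜ φ ⌝

open _[_]⇓⌜_⌝

⇓formula : ∀ {n} φ {xs : Vec ℕ n} → constᴿ ⌜ φ ⌝ [ xs ]⇓⌜ φ ⌝
⇓formula φ = ⌜ ⇓const ⌜ φ ⌝ ⌝⇓

allᴿ : ∀ {n} → Var → Rec n → Rec n
allᴿ x e = pairᴿ (constᴿ 4) (pairᴿ (constᴿ x) e)

⇓all : ∀ x {n} {e : Rec n} {xs φ} → e [ xs ]⇓⌜ φ ⌝ → allᴿ x e [ xs ]⇓⌜ all x φ ⌝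
⇓all x ⌜ p ⌝⇓ = ⌜ ⇓pair (⇓const 4) (⇓pair (⇓const x) p) ⌝⇓

⇒ᴿ : ∀ {n} → Rec n → Rec n → Rec n
⇒ᴿ e e′ = pairᴿ (constᴿ 2) (pairᴿ e e′)

⇓⇒ : ∀ {n} {e e′ : Rec n} {xs φ ψ} →
  e [ xs ]⇓⌜ φ ⌝ → e′ [ xs ]⇓⌜ ψ ⌝ → ⇒ᴿ e e′ [ xs ]⇓⌜ φ ⇒ ψ ⌝
⇓⇒ ⌜ p ⌝⇓ ⌜ q ⌝⇓ = ⌜ ⇓pair (⇓const 2) (⇓pair p q) ⌝⇓

⇛ᴿ : ∀ {n} → List Formula → Rec n → Rec n
⇛ᴿ Γ e = foldr (λ φ → ⇒ᴿ (constᴿ ⌜ φ ⌝)) e Γ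

⇓⇛ : ∀ Γ {n} {e : Rec n} {xs φ} → e [ xs ]⇓⌜ φ ⌝ → ⇛ᴿ Γ e [ xs ]⇓⌜ Γ ⇛ φ ⌝
⇓⇛ []      p = p
⇓⇛ (ψ ∷ Γ) p = ⇓⇒ (⇓formula ψ) (⇓⇛ Γ p)

stepᴿ : ∀ {n} → Rec n → Rec n
stepᴿ e = allᴿ 1 (⇒ᴿ (constᴿ ⌜ eqF 0 1 ⌝) (allᴿ 0 (⇒ᴿ (constᴿ ⌜ sucF 1 0 ⌝) e)))

⇓step : ∀ {n} {e : Rec n} {xs φ} → e [ xs ]⇓⌜ φ ⌝ → stepᴿ e [ xs ]⇓⌜ stepF φ ⌝
⇓step p = ⇓all 1 (⇓⇒ (⇓formula (eqF 0 1)) (⇓all 0 (⇓⇒ (⇓formula (sucF 1 0)) p)))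

⇓precₛ⌜_⌝ : ∀ {n} {b : Rec n} {s xs t φ} ψ → prec b s [ t ∷ xs ]⇓⌜ φ ⌝ →
  s [ t ∷ ⌜ φ ⌝ ∷ xs ]⇓⌜ ψ ⌝ → prec b s [ suc t ∷ xs ]⇓⌜ ψ ⌝
⇓precₛ⌜ _ ⌝ ⌜ p ⌝⇓ ⌜ q ⌝⇓ = ⌜ ⇓precₛ p q ⌝⇓

stepsᴿ : Rec 2
stepsᴿ = prec (proj zero) (stepᴿ (proj (suc zero)))

⇓steps : ∀ k φ → stepsᴿ [ k ∷ ⌜ φ ⌝ ∷ [] ]⇓⌜ stepsF k φ ⌝
⇓steps zero    φ = ⌜ ⇓prec₀ (⇓proj zero) ⌝⇓
⇓steps (suc k) φ = ⇓precₛ⌜ stepF (stepsF k φ) ⌝ (⇓steps k φ) (⇓step {φ = stepsF k φ} ⌜ ⇓proj (suc zero) ⌝⇓)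

-- The input is used twice, as the number of steps and as the formula: this is the substitution of a
-- formula's own code.
letᴿ : Rec 1
letᴿ = allᴿ 0 (⇒ᴿ (constᴿ ⌜ zeroF 0 ⌝) (comp stepsᴿ (proj zero ∷ proj zero ∷ [])))

⇓let : ∀ φ → letᴿ [ ⌜ φ ⌝ ∷ [] ]⇓⌜ letF ⌜ φ ⌝ φ ⌝
⇓let φ = ⇓all 0 (⇓⇒ (⇓formula (zeroF 0))
  ⌜ ⇓comp (⇓proj zero ∷ ⇓proj zero ∷ []) (computes (⇓steps ⌜ φ ⌝ φ)) ⌝⇓)

singletonᴿ : ∀ {n} → Rec n → Rec n
singletonᴿ e = comp sucᴿ (pairᴿ e zeroᴿ ∷ [])

⇓singleton : ∀ {n} {e : Rec n} {xs φ} → e [ xs ]⇓⌜ φ ⌝ → singletonᴿ e [ xs ]⇓ ⌜ φ ∷ [] ⌝*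
⇓singleton ⌜ p ⌝⇓ = ⇓comp (⇓pair p ⇓zero ∷ []) ⇓suc

-- The output is a one-element list because `theorems` speaks of lists.
diagonalizationᴿ : List Formula → Rec 1
diagonalizationᴿ Γ = singletonᴿ (⇛ᴿ Γ letᴿ)

⇓diagonalization : ∀ Γ φ → diagonalizationᴿ Γ [ ⌜ φ ⌝ ∷ [] ]⇓ ⌜ (Γ ⇛ letF ⌜ φ ⌝ φ) ∷ [] ⌝*
⇓diagonalization Γ φ = ⇓singleton {φ = Γ ⇛ letF ⌜ φ ⌝ φ} (⇓⇛ Γ (⇓let φ))

-- Opaque, because codes of concrete programs and formulas are too large to be computed.
opaque
  diagonalᴿ : Rec 1
  diagonalᴿ = diagonalizationᴿ axioms

  ⇓diagonal : ∀ φ → diagonalᴿ [ ⌜ φ ⌝ ∷ [] ]⇓ ⌜ (axioms ⇛ letF ⌜ φ ⌝ φ) ∷ [] ⌝*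
  ⇓diagonal φ = ⇓diagonalization axioms φ

-- Variable 0 is the code of the diagonalization, variable 2 that of the diagonalized formula,
-- and variable 3 that of the inference checker.
matrix : Formula
matrix = all 1 (all 4 (all 5 (all 6 (zeroF 4 ⇒ relF pairing 1 2 4 5 ⇒ relF evaluation 1 0 5 6 ⇒
  neg (relF theorems 1 3 6 6)))))

-- Meant to be used under `letF c`, with `c` in variable 0. Each number is copied by `eqF` to a
-- variable that the next `letF` preserves.
unprovableF : ℕ → ℕ → Formula
unprovableF k δ = all 2 (eqF 0 2 ⇒ letF k (all 3 (eqF 0 3 ⇒ letF δ matrix)))

-- What `matrix` says in the standard model. The value `x` is the code of the one-element vector of
-- `c`.
Unprovable : ℕ → ℕ → ℕ → Set
Unprovable k δ c = ∀ n x y →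
  Stage n pairing c 0 x → Stage n evaluation δ x y → Stage n theorems k y y → ⊥

-- Validity of the unprovability sentence

module _ (em : ExcludedMiddle 0ℓ) where

  -- By `rel-sound`, tuples refuting `matrix` in any model of the axioms would yield numbers
  -- refuting `Unprovable`.
  unprovable-valid : ∀ {k δ c} → Unprovable k δ c → L Stalnakerian (axioms ⇛ letF c (unprovableF k δ))
  unprovable-valid {k} {δ} {c} unprovable F stal M w g =
    Semantics.⇛-intro em M axioms {letF c (unprovableF k δ)} {g} λ
      { (p₁ ∷ p₂ ∷ p₃ ∷ p₄ ∷ p₅ ∷ p₆ ∷ p₇ ∷ c₁ ∷ c₂ ∷ c₃ ∷ c₄ ∷ c₅ ∷ c₆ ∷ []) →
        let open Standardness em stal M w g p₁ p₂ p₃ p₄ p₅ p₆ p₇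
              (λ { pairing → c₁ ; nth → c₂ ; evaluation → c₃ ; evaluations → c₄ ; below → c₅ ; theorems → c₆ })
        in letF-intro c (unprovableF k δ) {g} λ h _ h∈ c≡ a a∈ e →
           letF-intro k (all 3 (eqF 0 3 ⇒ letF δ matrix)) {h [ 2 ≔ a ]} λ h′ same h′∈ k≡ b b∈ e′ →
           letF-intro δ matrix {h′ [ 3 ≔ b ]} λ h″ same′ h″∈ δ≡ n n∈ z z∈ x x∈ y y∈ zero-z →
           -- Variable 2 has survived two uses of `letF`, variable 3 one.
           let a≡ = trans (same′ 0) (same 0)
               b≡ = same′ 1
               number-a = trans (cong number a≡) (trans (sym (number-eq h∈ a∈ e)) c≡)
               number-b = trans (cong number b≡) (trans (sym (number-eq h′∈ b∈ e′)) k≡)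
               a∈′ = subst (_∈ SelectionFrame.d F w) (sym a≡) a∈
               b∈′ = subst (_∈ SelectionFrame.d F w) (sym b≡) b∈
           in λ p q r → unprovable (number n) (number x) (number y)
             (subst₂ (λ i j → Stage (number n) pairing i j (number x)) number-a (number-zero z∈ zero-z)
               (rel-sound _ pairing n∈ a∈′ z∈ x∈ refl p))
             (subst (λ i → Stage (number n) evaluation i (number x) (number y)) δ≡
               (rel-sound _ evaluation n∈ h″∈ x∈ y∈ refl q))
             (subst (λ i → Stage (number n) theorems i (number y) (number y)) number-b
               (rel-sound _ theorems n∈ b∈′ y∈ y∈ refl r)) }

  -- Validity is applied to the standard model at world 0.
  valid-unprovable : ∀ {k δ c} → L Stalnakerian (axioms ⇛ letF c (unprovableF k δ)) → Unprovable k δ c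
  valid-unprovable {k} {δ} {c} valid n x y
    with h , _ , refl , p ← Standard.letF-elim em c (unprovableF k δ) {λ _ → 0}
      (Semantics.⇛-elim em (Standard.model em) axioms {letF c (unprovableF k δ)} {λ _ → 0}
        (valid (Standard.frame em) (Standard.frame-stalnakerian em) (Standard.model em) 0 (λ _ → 0))
        (Standard.axioms-true em (λ _ → 0)))
    with h′ , same , refl , p′ ← Standard.letF-elim em k (all 3 (eqF 0 3 ⇒ letF δ matrix)) {h [ 2 ≔ h 0 ]} (p (h 0) tt refl)
    with h″ , same′ , refl , p″ ← Standard.letF-elim em δ matrix {h′ [ 3 ≔ h′ 0 ]} (p′ (h′ 0) tt refl)
    = λ q r s → p″ n tt 0 tt x tt y tt refl
        (subst (λ i → Stage n pairing i 0 x) (sym (trans (same′ 0) (same 0))) q) r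
        (subst (λ i → Stage n theorems i y y) (sym (same′ 1)) s)

-- The diagonal argument for a formal system

module _ (S : FormalSystem) where

  open Meaning (inferenceᴿ S) (Theorem S) (inference-sound S)

  -- By soundness of the clauses and determinism, a counterexample would give a list of theorems
  -- with the code of `ψ ∷ []`.
  non-theorem-unprovable : ∀ {c e ψ} → e [ c ∷ [] ]⇓ ⌜ ψ ∷ [] ⌝* → ¬ Theorem S ψ →
    Unprovable (codeRec (inferenceᴿ S)) (codeRec e) c
  non-theorem-unprovable {c} {e} {ψ} e⇓ ¬thm n _ _ p q r
    with refl ← ⇓-deterministic e
           (Stage-least Means means-closed n evaluation q e (c ∷ []) refl
             (Stage-least Means means-closed n pairing p))
           e⇓
    with Γ , eq , hs ← Stage-least Means means-closed n theorems r refl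
    with refl ← ⌜⌝*-injective Γ (ψ ∷ []) eq
    with h ∷ [] ← hs = ¬thm h

  theorem-not-unprovable : ∀ {c e ψ} → e [ c ∷ [] ]⇓ ⌜ ψ ∷ [] ⌝* → Theorem S ψ →
    ¬ Unprovable (codeRec (inferenceᴿ S)) (codeRec e) c
  theorem-not-unprovable {c} {e} {ψ} e⇓ thm unprovable
    with l , p ← pairing-derivable c 0
       | m , q ← evaluation-derivable e e⇓
       | n , r ← theorems-derivable S ⌜ ψ ∷ [] ⌝* (thm ∷ [])
    -- `Unprovable` asks for one common stage, and stages increase.
    = unprovable (l ⊔ (m ⊔ n)) _ _
        (Stage-mono (m≤m⊔n l (m ⊔ n)) pairing p)
        (Stage-mono (≤-trans (m≤m⊔n m n) (m≤n⊔m l (m ⊔ n))) evaluation q)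
        (Stage-mono (≤-trans (m≤n⊔m m n) (m≤n⊔m l (m ⊔ n))) theorems r)

  -- If `ψ` is not a theorem, it is unprovable, hence in `A`, hence a theorem; if it is a theorem,
  -- it is in `A`, hence unprovable, against `theorem-not-unprovable`.
  not-axiomatized : ∀ {A : Pred Formula (lsuc 0ℓ)} {c e ψ} → e [ c ∷ [] ]⇓ ⌜ ψ ∷ [] ⌝* →
    (Unprovable (codeRec (inferenceᴿ S)) (codeRec e) c → A ψ) →
    (A ψ → Unprovable (codeRec (inferenceᴿ S)) (codeRec e) c) →
    ¬ (∀ φ → A φ ⇔ Theorem S φ)
  not-axiomatized {ψ = ψ} e⇓ sound complete axiomatizes = refute λ thm →
    theorem-not-unprovable e⇓ thm (complete (Equivalence.from (axiomatizes ψ) thm))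
    where
    refute : ¬ ¬ Theorem S ψ
    refute ¬thm = ¬thm (Equivalence.to (axiomatizes ψ) (sound (non-theorem-unprovable e⇓ ¬thm)))

corollary5 : ExcludedMiddle 0ℓ → ¬ RecursivelyAxiomatizable (L Stalnakerian)
corollary5 em (S , axiomatizes) = refute (unprovableF k δ) refl
  where
  k δ : ℕ
  k = codeRec (inferenceᴿ S)
  δ = codeRec diagonalᴿ
  -- With φ a variable, its code is not computed.
  refute : ∀ φ → ¬ φ ≡ unprovableF k δ
  -- The fixed point: `diagonalᴿ` maps the code of `φ` to that of the list whose only entry is the
  -- sentence `axioms ⇛ letF ⌜ φ ⌝ φ` itself.
  refute φ eq = not-axiomatized S {L Stalnakerian} {⌜ φ ⌝} {diagonalᴿ} {axioms ⇛ letF ⌜ φ ⌝ φ} (⇓diagonal φ)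
    (λ u → subst (λ χ → L Stalnakerian (axioms ⇛ letF ⌜ φ ⌝ χ)) (sym eq)
      (unprovable-valid em {k} {δ} {⌜ φ ⌝} u))
    (λ v → valid-unprovable em {k} {δ} {⌜ φ ⌝}
      (subst (λ χ → L Stalnakerian (axioms ⇛ letF ⌜ φ ⌝ χ)) eq v))
    axiomatizes
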